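{- Every deterministic online algorithm with kill-and-restart for minimizing total flow time on a single machine has competitive ratio $\Omega(n/\log n)$, where $n$ is the number of jobs (even if $n$ is known in advance).
   Context: Online single-machine scheduling; each job $j$ has release time $r_j\ge0$ and processing time $p_j>0$ and becomes known only at $r_j$. The machine processes at most one job at a time. Kill-and-restart model: the algorithm may terminate a running job; all its processed work is lost and it must later be processed again from scratch for $p_j$ uninterrupted time units. Flow time of $j$ is $C_j-r_j$; objective is total flow time. For this lower bound, $\mathrm{OPT}(J)$ is the minimum total flow time over offline non-preemptive schedules. Competitive ratio $\Omega(\Gamma)$ means that for every $n$ there is an instance with $n$ jobs on which the algorithm's total flow time is at least $c\,\Gamma\cdot\mathrm{OPT}(J)$ for an absolute constant $c>0$.
   Formalization: Time is rational rather than real: release times, processing times and all start, kill and completion times of the online algorithm are rational numbers. -}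

module Defs where

open import Data.Nat as ℕ using (ℕ; zero; suc)
open import Data.Integer using (+_)
open import Data.Fin using (Fin) renaming (zero to fzero; suc to fsuc)
open import Data.Rational using (ℚ; 0ℚ; _+_; _-_; _*_; _≤_; _<_; _⊓_; _/_)
open import Data.Rational.Properties using (_<?_)
open import Data.List using (List; map; filter)
open import Data.List.Membership.Propositional using (_∈_)
open import Data.List.Relation.Unary.Linked using (Linked)
open import Data.Product using (Σ; _×_; _,_)
open import Data.Sum using (_⊎_)
open import Relation.Binary.PropositionalEquality using (_≡_)
open import Relation.Nullary using (¬_)

ℕtoℚ : ℕ → ℚ
ℕtoℚ n = (+ n) / 1

sumFin : (n : ℕ) → (Fin n → ℚ) → ℚ
sumFin zero    f = 0ℚ
sumFin (suc n) f = f fzero + sumFin n (λ j → f (fsuc j))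

record Instance (n : ℕ) : Set where
  field
    rel  : Fin n → ℚ
    proc : Fin n → ℚ
open Instance public

ValidInstance : {n : ℕ} → Instance n → Set
ValidInstance {n} J = (j : Fin n) → (0ℚ ≤ rel J j) × (0ℚ < proc J j)

record NPSchedule {n : ℕ} (J : Instance n) : Set where
  field
    st       : Fin n → ℚ
    released : (j : Fin n) → rel J j ≤ st j
    disjoint : (j k : Fin n) → ¬ (j ≡ k) →
               (st j + proc J j ≤ st k) ⊎ (st k + proc J k ≤ st j)
open NPSchedule public

npFlow : {n : ℕ} {J : Instance n} → NPSchedule J → ℚ
npFlow {n} {J} σ = sumFin n (λ j → (st σ j + proc J j) - rel J j)

-- one (maximal) uninterrupted processing interval [start, end) of a job
record Run (n : ℕ) : Set where
  constructor run
  field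
    job   : Fin n
    start : ℚ
    end   : ℚ
open Run public

NonOverlap : {n : ℕ} → Run n → Run n → Set
NonOverlap a b = end a ≤ start b

-- An execution of the machine on instance J: a finite chronological list of
-- runs.  A run of full length p_j completes the job; a shorter run is a run
-- that was killed (its work is lost).  comp j is the completion time C_j,
-- i.e. the end of the (unique) full-length run of j.
record Execution {n : ℕ} (J : Instance n) : Set where
  field
    runs       : List (Run n)
    ordered    : Linked NonOverlap runs
    afterRel   : ∀ {x} → x ∈ runs → rel J (job x) ≤ start x
    positive   : ∀ {x} → x ∈ runs → start x < end x
    notTooLong : ∀ {x} → x ∈ runs → end x - start x ≤ proc J (job x)
    comp       : Fin n → ℚ
    completes  : (j : Fin n) → run j (comp j - proc J j) (comp j) ∈ runs
    compUnique : ∀ {x} → x ∈ runs → end x - start x ≡ proc J (job x) →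
                 end x ≡ comp (job x)
open Execution public

execFlow : {n : ℕ} {J : Instance n} → Execution J → ℚ
execFlow {n} {J} E = sumFin n (λ j → comp E j - rel J j)

truncateAt : {n : ℕ} → ℚ → List (Run n) → List (Run n)
truncateAt t rs =
  map (λ x → run (job x) (start x) (end x ⊓ t)) (filter (λ x → start x <? t) rs)

AgreeBefore : {n : ℕ} → Instance n → Instance n → ℚ → Set
AgreeBefore {n} J J' t =
  (j : Fin n) → (rel J j < t ⊎ rel J' j < t) →
  (rel J j ≡ rel J' j) × (proc J j ≡ proc J' j)

-- A deterministic online algorithm with kill-and-restart for n jobs
-- (n is known to the algorithm): it maps every instance to an execution,
-- and its behaviour during [0, t) depends only on the jobs released before t.
record OnlineAlgorithm (n : ℕ) : Set where
  field
    execute : (J : Instance n) → ValidInstance J → Execution J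
    online  : (J J' : Instance n) (v : ValidInstance J) (v' : ValidInstance J')
              (t : ℚ) → AgreeBefore J J' t →
              truncateAt t (runs (execute J v)) ≡ truncateAt t (runs (execute J' v'))
open OnlineAlgorithm public

{-# OPTIONS --safe #-}
module Submission where

-- The jobs are a job of size 2h, one of size 4h (both released at 0) and n - 2 tiny jobs of size 1,
-- where h = (L + 1) u, L = ⌊log₂ n⌋ and u = n². The first half of the tiny jobs arrives at 2h or
-- at 4h, chosen so that either all of them wait for 2h, or some long job p is still unfinished at
-- 8h although an offline schedule can be done with both long jobs by 7h.
-- In the second case bursts of 1, 2, 4, … tiny jobs arrive at intervals u during the run of p that
-- would complete p. If the algorithm lets p run, each burst waits for at least u; if it kills p,
-- then p is delayed by at least u. As each burst is barely larger than all earlier bursts of the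
-- run together, the total flow time grows by at least u / 2 per tiny job used, while offline every
-- tiny job is served immediately. So the algorithm pays Ω(n u), the offline schedule O(h) = O(L u).

open import Defs
open import Data.Nat using (ℕ; _≤_)
open import Data.Nat.Logarithm using (⌊log₂_⌋)
open import Data.Rational using (ℚ; 0ℚ; _*_; _<_)
open import Data.Product using (Σ; _×_)
import Data.Rational as Q

open import Data.Nat using (zero; suc)
open import Data.Nat.Logarithm using (⌊log₂⌋-mono-≤; ⌊log₂[2^n]⌋≡n)
import Data.Nat as ℕ
import Data.Nat.Properties as ℕ
open import Data.Rational using (1ℚ; _+_; _-_; _⊓_)
import Data.Rational.Properties as Q
import Data.Integer as ℤ
import Data.Integer.Properties as ℤ
import Data.Rational.Unnormalised as ℚᵘ
import Data.Rational.Unnormalised.Properties as ℚᵘ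
open import Data.Fin using (Fin; toℕ) renaming (zero to fzero; suc to fsuc)
open import Data.Fin.Properties using (toℕ<n; toℕ-injective)
open import Data.List using (_∷_)
open import Data.List.Membership.Propositional using (_∈_)
open import Data.List.Membership.Propositional.Properties
  using (∈-map⁺; ∈-map⁻; ∈-filter⁺; ∈-filter⁻)
open import Data.List.Relation.Unary.Any using (here; there)
open import Data.List.Relation.Unary.Linked as Linked using (Linked)
open import Data.Product using (_,_; proj₁; ∃-syntax)
open import Data.Sum as Sum using (_⊎_; inj₁; inj₂; [_,_]′)
open import Data.Empty using (⊥-elim)
open import Function using (_∘_; const)
open import Level using (0ℓ)
open import Relation.Nullary using (¬_; yes; no; contradiction)
open import Relation.Nullary.Decidable using (dec⇒maybe)
open import Relation.Binary.Definitions using (tri<; tri≈; tri>)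
open import Relation.Binary.PropositionalEquality
  using (_≡_; _≢_; refl; sym; trans; cong; cong₂; subst; subst₂)
open import Data.Nat.Tactic.RingSolver using () renaming (solve-∀ to ℕ-solve-∀)
open import Tactic.RingSolver using (solve-∀)
open import Tactic.RingSolver.Core.AlmostCommutativeRing
  using (AlmostCommutativeRing; fromCommutativeRing)

-- Linear arithmetic over ℚ

ringℚ : AlmostCommutativeRing 0ℓ 0ℓ
ringℚ = fromCommutativeRing Q.+-*-commutativeRing (λ x → dec⇒maybe (0ℚ Q.≟ x))

infixl 6 _⊕_
_⊕_ : ∀ {a b c d} → a Q.≤ b → c Q.≤ d → a + c Q.≤ b + d
_⊕_ = Q.+-mono-≤

-- To derive x ≤ y, add up hypotheses to l ≤ r such that x + r = y + l is a ring identity.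
≤-from : ∀ {x y l r} → l Q.≤ r → x + r ≡ y + l → x Q.≤ y
≤-from {x} {y} {l} {r} l≤r eq = subst₂ Q._≤_ (cancel x l) (cancel y l)
  (Q.+-monoˡ-≤ (Q.- l) (subst (x + l Q.≤_) eq (Q.+-monoʳ-≤ x l≤r)))
  where
  cancel : ∀ a b → (a + b) + Q.- b ≡ a
  cancel = solve-∀ ringℚ

0≤-diff : ∀ {x y} → x Q.≤ y → 0ℚ Q.≤ y - x
0≤-diff {x} {y} x≤y = ≤-from x≤y (identity x y)
  where
  identity : ∀ x y → 0ℚ + y ≡ (y - x) + x
  identity = solve-∀ ringℚ

≤⇒≯ : ∀ {x y} → x Q.≤ y → ¬ (y < x)
≤⇒≯ x≤y y<x = Q.<-irrefl refl (Q.≤-<-trans x≤y y<x)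

≤-<-connex : ∀ x y → (x Q.≤ y) ⊎ (y < x)
≤-<-connex x y with x Q.≤? y
... | yes x≤y = inj₁ x≤y
... | no  x≰y = inj₂ (Q.≰⇒> x≰y)

-- Natural numbers as rationals

toℚᵘ-ℕtoℚ : ∀ n → Q.toℚᵘ (ℕtoℚ n) ℚᵘ.≃ ℚᵘ.mkℚᵘ (ℤ.+ n) 0
toℚᵘ-ℕtoℚ n = Q.toℚᵘ-fromℚᵘ (ℚᵘ.mkℚᵘ (ℤ.+ n) 0)

ℕtoℚ-mono : ∀ {a b} → a ≤ b → ℕtoℚ a Q.≤ ℕtoℚ b
ℕtoℚ-mono {a} {b} a≤b = Q.toℚᵘ-cancel-≤
  (ℚᵘ.≤-respˡ-≃ (ℚᵘ.≃-sym (toℚᵘ-ℕtoℚ a)) (ℚᵘ.≤-respʳ-≃ (ℚᵘ.≃-sym (toℚᵘ-ℕtoℚ b))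
    (ℚᵘ.*≤* (ℤ.*-monoʳ-≤-nonNeg (ℤ.+ 1) (ℤ.+≤+ a≤b)))))

ℕtoℚ-+ : ∀ a b → ℕtoℚ (a ℕ.+ b) ≡ ℕtoℚ a + ℕtoℚ b
ℕtoℚ-+ a b = Q.toℚᵘ-injective (ℚᵘ.≃-trans (toℚᵘ-ℕtoℚ (a ℕ.+ b)) (ℚᵘ.≃-trans
  (ℚᵘ.*≡* (cong (ℤ._* ℤ.+ 1) (sym (cong₂ ℤ._+_ (ℤ.*-identityʳ (ℤ.+ a)) (ℤ.*-identityʳ (ℤ.+ b))))))
  (ℚᵘ.≃-sym (ℚᵘ.≃-trans (Q.toℚᵘ-homo-+ (ℕtoℚ a) (ℕtoℚ b))
    (ℚᵘ.+-cong (toℚᵘ-ℕtoℚ a) (toℚᵘ-ℕtoℚ b))))))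

infixr 7 _·_
opaque
  _·_ : ℕ → ℚ → ℚ
  n · x = ℕtoℚ n * x

  0-· : ∀ x → 0 · x ≡ 0ℚ
  0-· = Q.*-zeroˡ

  1-· : ∀ x → 1 · x ≡ x
  1-· = Q.*-identityˡ

  ·-0 : ∀ n → n · 0ℚ ≡ 0ℚ
  ·-0 n = Q.*-zeroʳ (ℕtoℚ n)

  suc-· : ∀ n x → suc n · x ≡ x + n · x
  suc-· n x = trans (cong (_* x) (ℕtoℚ-+ 1 n)) (distrib (ℕtoℚ n) x)
    where
    distrib : ∀ k x → (1ℚ + k) * x ≡ x + k * x
    distrib = solve-∀ ringℚ

  +-· : ∀ a b x → (a ℕ.+ b) · x ≡ a · x + b · x
  +-· a b x = trans (cong (_* x) (ℕtoℚ-+ a b)) (Q.*-distribʳ-+ x (ℕtoℚ a) (ℕtoℚ b))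

  ℕtoℚ-* : ∀ a b → ℕtoℚ (a ℕ.* b) ≡ a · ℕtoℚ b
  ℕtoℚ-* zero    b = sym (Q.*-zeroˡ (ℕtoℚ b))
  ℕtoℚ-* (suc a) b = trans (ℕtoℚ-+ b (a ℕ.* b))
    (trans (cong (ℕtoℚ b +_) (ℕtoℚ-* a b)) (sym (suc-· a (ℕtoℚ b))))

  *-· : ∀ a b x → (a ℕ.* b) · x ≡ a · b · x
  *-· a b x = trans (cong (_* x) (ℕtoℚ-* a b)) (Q.*-assoc (ℕtoℚ a) (ℕtoℚ b) x)

  ·-monoʳ : ∀ n {x y} → x Q.≤ y → n · x Q.≤ n · y
  ·-monoʳ n x≤y = Q.*-monoˡ-≤-nonNeg (ℕtoℚ n) {{Q.nonNegative (ℕtoℚ-mono {0} {n} ℕ.z≤n)}} x≤y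

  ·-monoˡ : ∀ {a b x} → 0ℚ Q.≤ x → a ≤ b → a · x Q.≤ b · x
  ·-monoˡ {x = x} 0≤x a≤b = Q.*-monoʳ-≤-nonNeg x {{Q.nonNegative 0≤x}} (ℕtoℚ-mono a≤b)

  ·-nonNeg : ∀ n {x} → 0ℚ Q.≤ x → 0ℚ Q.≤ n · x
  ·-nonNeg n {x} 0≤x = subst (Q._≤ n · x) (Q.*-zeroˡ x) (·-monoˡ {0} {n} 0≤x ℕ.z≤n)

-- Prefix sums

prefixSum : (ℕ → ℚ) → ℕ → ℚ
prefixSum f zero    = 0ℚ
prefixSum f (suc n) = f 0 + prefixSum (f ∘ suc) n

-- Serves for release times, where the jobs from `n` on get one common date, and for the waiting
-- times of a new burst. It recurses in parallel with `prefixSum`, which makes `prefixSum-cutoff` a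
-- direct induction.
cutoff : (ℕ → ℚ) → ℕ → ℚ → ℕ → ℚ
cutoff f zero    v j       = v
cutoff f (suc n) v zero    = f 0
cutoff f (suc n) v (suc j) = cutoff (f ∘ suc) n v j

cutoff-< : ∀ f {n} v {j} → j ℕ.< n → cutoff f n v j ≡ f j
cutoff-< f v {zero}  (ℕ.s≤s _)   = refl
cutoff-< f v {suc j} (ℕ.s≤s j<n) = cutoff-< (f ∘ suc) v j<n

cutoff-≥ : ∀ f {n} v {j} → n ≤ j → cutoff f n v j ≡ v
cutoff-≥ f v ℕ.z≤n       = refl
cutoff-≥ f v (ℕ.s≤s n≤j) = cutoff-≥ (f ∘ suc) v n≤j

prefixSum-const : ∀ v b → prefixSum (const v) b ≡ b · v
prefixSum-const v zero    = sym (0-· v)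
prefixSum-const v (suc b) = trans (cong (v +_) (prefixSum-const v b)) (sym (suc-· b v))

prefixSum-cutoff : ∀ f n v b → prefixSum (cutoff f n v) (n ℕ.+ b) ≡ prefixSum f n + b · v
prefixSum-cutoff f zero    v b = trans (prefixSum-const v b) (sym (Q.+-identityˡ (b · v)))
prefixSum-cutoff f (suc n) v b = trans (cong (f 0 +_) (prefixSum-cutoff (f ∘ suc) n v b))
  (sym (Q.+-assoc (f 0) (prefixSum (f ∘ suc) n) (b · v)))

sumFin-≥0 : ∀ m {f} → (∀ j → 0ℚ Q.≤ f j) → 0ℚ Q.≤ sumFin m f
sumFin-≥0 zero    f≥0 = Q.≤-refl
sumFin-≥0 (suc m) f≥0 = f≥0 fzero ⊕ sumFin-≥0 m (f≥0 ∘ fsuc)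

prefixSum≤sumFin : ∀ {m n} {f : Fin m → ℚ} {g} → n ≤ m →
  (∀ j → toℕ j ℕ.< n → g (toℕ j) Q.≤ f j) → (∀ j → 0ℚ Q.≤ f j) →
  prefixSum g n Q.≤ sumFin m f
prefixSum≤sumFin {m} ℕ.z≤n g≤f f≥0 = sumFin-≥0 m f≥0
prefixSum≤sumFin (ℕ.s≤s n≤m) g≤f f≥0 =
  g≤f fzero (ℕ.s≤s ℕ.z≤n)
    ⊕ prefixSum≤sumFin n≤m (λ j j<n → g≤f (fsuc j) (ℕ.s≤s j<n)) (f≥0 ∘ fsuc)

sumFin≤· : ∀ m {f v} → (∀ j → f j Q.≤ v) → sumFin m f Q.≤ m · v
sumFin≤· zero    {v = v} f≤v = Q.≤-reflexive (sym (0-· v))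
sumFin≤· (suc m) {v = v} f≤v = subst (_ Q.≤_) (sym (suc-· m v)) (f≤v fzero ⊕ sumFin≤· m (f≤v ∘ fsuc))

-- Executions

before-tail : ∀ {n} {x y : Run n} {xs} → Linked NonOverlap (x ∷ xs) →
  (∀ {z} → z ∈ xs → start z < end z) → y ∈ xs → end x Q.≤ start y
before-tail (r Linked.∷ _) pos (here refl) = r
before-tail (r Linked.∷ l) pos (there y∈)  =
  Q.≤-trans r (Q.≤-trans (Q.<⇒≤ (pos (here refl))) (before-tail l (pos ∘ there) y∈))

tail : ∀ {n} {x : Run n} {xs} → Linked NonOverlap (x ∷ xs) → Linked NonOverlap xs
tail Linked.[-]     = Linked.[]
tail (_ Linked.∷ l) = l

comparable : ∀ {n} {x y : Run n} {rs} → Linked NonOverlap rs → (∀ {z} → z ∈ rs → start z < end z) →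
  x ∈ rs → y ∈ rs → (x ≡ y) ⊎ (end x Q.≤ start y) ⊎ (end y Q.≤ start x)
comparable l pos (here refl) (here refl) = inj₁ refl
comparable l pos (here refl) (there y∈)  = inj₂ (inj₁ (before-tail l (pos ∘ there) y∈))
comparable l pos (there x∈)  (here refl) = inj₂ (inj₂ (before-tail l (pos ∘ there) x∈))
comparable l pos (there x∈)  (there y∈)  = comparable (tail l) (pos ∘ there) x∈ y∈

module _ {n : ℕ} {J : Instance n} (E : Execution J) where

  begun : Fin n → ℚ
  begun j = comp E j - proc J j

  fullRun : Fin n → Run n
  fullRun j = run j (begun j) (comp E j)

  rel≤begun : ∀ j → rel J j Q.≤ begun j
  rel≤begun j = afterRel E (completes E j)

  begun<comp : ∀ j → begun j < comp E j
  begun<comp j = positive E (completes E j)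

  comp≡begun+proc : ∀ j → comp E j ≡ begun j + proc J j
  comp≡begun+proc j = cancel (comp E j) (proc J j)
    where
    cancel : ∀ c p → c ≡ (c - p) + p
    cancel = solve-∀ ringℚ

  runs-comparable : ∀ {x y} → x ∈ runs E → y ∈ runs E →
    (x ≡ y) ⊎ (end x Q.≤ start y) ⊎ (end y Q.≤ start x)
  runs-comparable = comparable (ordered E) (positive E)

  overlapping-runs-equal : ∀ {x y} → x ∈ runs E → y ∈ runs E →
    start x < end y → start y < end x → x ≡ y
  overlapping-runs-equal x∈ y∈ x<y y<x with runs-comparable x∈ y∈
  ... | inj₁ x≡y        = x≡y
  ... | inj₂ (inj₁ x≤y) = contradiction y<x (≤⇒≯ x≤y)
  ... | inj₂ (inj₂ y≤x) = contradiction x<y (≤⇒≯ y≤x)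

  -- The full run of `j` cannot come first: it would have to end by `begun k`, and so by the release
  -- of `j`.
  waits-for : ∀ {j k} → j ≢ k → begun k Q.≤ rel J j → comp E k Q.≤ begun j
  waits-for {j} {k} j≢k k≤j with runs-comparable (completes E j) (completes E k)
  ... | inj₁ eq         = contradiction (cong job eq) j≢k
  ... | inj₂ (inj₁ c≤b) = contradiction (begun<comp j)
                            (≤⇒≯ (Q.≤-trans c≤b (Q.≤-trans k≤j (rel≤begun j))))
  ... | inj₂ (inj₂ c≤b) = c≤b

-- Executions that agree up to a time

⊓-reflects-< : ∀ {a b t} → a ⊓ t ≡ b ⊓ t → a < t → b ≡ a
⊓-reflects-< {a} {b} {t} eq a<t with Q.≤-total b t
... | inj₁ b≤t = trans (sym (Q.p≤q⇒p⊓q≡p b≤t)) (trans (sym eq) (Q.p≤q⇒p⊓q≡p (Q.<⇒≤ a<t)))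
... | inj₂ t≤b = contradiction (Q.≤-reflexive (trans (sym (Q.p≥q⇒p⊓q≡q t≤b))
                   (trans (sym eq) (Q.p≤q⇒p⊓q≡p (Q.<⇒≤ a<t))))) (λ t≤a → ≤⇒≯ t≤a a<t)

⊓-reflects-≥ : ∀ {a b t} → a ⊓ t ≡ b ⊓ t → t Q.≤ a → t Q.≤ b
⊓-reflects-≥ {a} {b} {t} eq t≤a =
  subst (Q._≤ b) (trans (sym eq) (Q.p≥q⇒p⊓q≡q t≤a)) (Q.p⊓q≤p b t)

module Indistinguishable {n : ℕ} {J J′ : Instance n} (E : Execution J) (E′ : Execution J′)
  (sameProc : ∀ j → proc J j ≡ proc J′ j)
  (t : ℚ) (sameRuns : truncateAt t (runs E) ≡ truncateAt t (runs E′)) where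

  run-transfer : ∀ {x} → x ∈ runs E′ → start x < t →
    ∃[ y ] (y ∈ runs E × job y ≡ job x × start y ≡ start x × end y ⊓ t ≡ end x ⊓ t)
  run-transfer {x} x∈ x<t
    with ∈-map⁻ _ (subst (run (job x) (start x) (end x ⊓ t) ∈_) (sym sameRuns)
           (∈-map⁺ _ (∈-filter⁺ (λ x → start x Q.<? t) x∈ x<t)))
  ... | y , y∈ , eq = y , proj₁ (∈-filter⁻ (λ x → start x Q.<? t) y∈)
                        , sym (cong job eq) , sym (cong start eq) , sym (cong end eq)

  -- Truncation at `t` leaves a run that ends before `t` unchanged, so it occurs in `E` with full
  -- length, and `compUnique` identifies its end with the completion time there.
  completion-transfer : ∀ {j} → comp E′ j < t → comp E j ≡ comp E′ j
  completion-transfer {j} c<t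
    with run-transfer (completes E′ j) (Q.<-trans (begun<comp E′ j) c<t)
  ... | run _ _ e , y∈ , refl , refl , ends
    with ⊓-reflects-< {b = e} (sym ends) c<t
  ... | refl = sym (compUnique E y∈ (trans (cancel (comp E′ j) (proc J′ j)) (sym (sameProc j))))
    where
    cancel : ∀ c p → c - (c - p) ≡ p
    cancel = solve-∀ ringℚ

  comp-≥-transfer : ∀ {d j} → d Q.≤ t → d Q.≤ comp E j → d Q.≤ comp E′ j
  comp-≥-transfer {d} {j} d≤t d≤c with d Q.≤? comp E′ j
  ... | yes d≤c′ = d≤c′
  ... | no  d≰c′ = subst (d Q.≤_) (completion-transfer (Q.<-≤-trans (Q.≰⇒> d≰c′) d≤t)) d≤c

  -- If the completing run of `j` in `E′` starts before `t`, it is still in progress at `t`, because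
  -- `j` is not complete before `t` in `E`. The run of `E` with the same start then overlaps the
  -- completing run of `E`, so the two coincide.
  same-run-or-fresh : ∀ {j} → begun E j < t → t Q.≤ comp E j →
    (comp E′ j ≡ comp E j) ⊎ (t Q.≤ begun E′ j)
  same-run-or-fresh {j} b<t t≤c with t Q.≤? begun E′ j
  ... | yes t≤b′ = inj₂ t≤b′
  ... | no  t≰b′ with run-transfer (completes E′ j) (Q.≰⇒> t≰b′)
  ... | run _ _ e , y∈ , refl , refl , ends = inj₁ same
    where
    t≤c′ : t Q.≤ comp E′ j
    t≤c′ = comp-≥-transfer Q.≤-refl t≤c
    t≤e : t Q.≤ e
    t≤e = ⊓-reflects-≥ {b = e} (sym ends) t≤c′
    same : comp E′ j ≡ comp E j
    same = trans (comp≡begun+proc E′ j) (trans (cong₂ _+_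
      (cong start (overlapping-runs-equal E y∈ (completes E j)
        (Q.<-≤-trans (Q.≰⇒> t≰b′) t≤c) (Q.<-≤-trans b<t t≤e)))
      (sym (sameProc j))) (sym (comp≡begun+proc E j)))

  -- In `E` too the machine is occupied by `j` just before `t`; a completing run of `k` begun before
  -- `t` would overlap that run.
  busy-transfer : ∀ {j k} → j ≢ k → begun E′ j < t → t Q.≤ comp E′ j →
    t Q.≤ comp E k → t Q.≤ begun E k
  busy-transfer {j} {k} j≢k b<t t≤c t≤cₖ with t Q.≤? begun E k
  ... | yes t≤b = t≤b
  ... | no  t≰b with run-transfer (completes E′ j) b<t
  ... | run _ _ e , y∈ , refl , refl , ends = ⊥-elim (j≢k (cong job
    (overlapping-runs-equal E y∈ (completes E k) (Q.<-≤-trans b<t t≤cₖ)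
      (Q.<-≤-trans (Q.≰⇒> t≰b) (⊓-reflects-≥ {b = e} (sym ends) t≤c)))))

-- The adversary

-- `B₀` tiny jobs form the first burst, the other `B` feed the later ones. `window` fits `suc L`
-- intervals `u` into the last `h` of a run, `2^≤⇒≤L` limits the doublings, and `m²≤h` pays for the
-- offline flow of the tiny jobs.
module Adversary (m L B₀ B : ℕ) (A : OnlineAlgorithm (2 ℕ.+ m)) (u h : ℚ) (0<u : 0ℚ < u)
  (B₀+B≡m : B₀ ℕ.+ B ≡ m) (B₀≤B : B₀ ≤ B) (B≤1+B₀ : B ≤ suc B₀)
  (window : suc L · u Q.≤ h) (2^≤⇒≤L : ∀ i → 2 ℕ.^ i ≤ 2 ℕ.+ m → i ≤ L)
  (m²≤h : ℕtoℚ (m ℕ.* m) Q.≤ h) where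

  n : ℕ
  n = 2 ℕ.+ m

  pattern job₂ = fzero
  pattern job₄ = fsuc fzero
  pattern tiny j = fsuc (fsuc j)

  size : Fin n → ℚ
  size job₂     = 2 · h
  size job₄     = 4 · h
  size (tiny _) = 1ℚ

  jobs : (ℕ → ℚ) → Instance n
  rel  (jobs r) job₂     = 0ℚ
  rel  (jobs r) job₄     = 0ℚ
  rel  (jobs r) (tiny j) = r (toℕ j)
  proc (jobs r) = size

  data Long : Fin n → Set where
    long₂ : Long job₂
    long₄ : Long job₄

  0≤u : 0ℚ Q.≤ u
  0≤u = Q.<⇒≤ 0<u

  u≤h : u Q.≤ h
  u≤h = Q.≤-trans (subst (u Q.≤_) (sym (suc-· L u)) (u≤u+ (L · u) (·-nonNeg L 0≤u))) window
    where
    u≤u+ : ∀ v → 0ℚ Q.≤ v → u Q.≤ u + v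
    u≤u+ v 0≤v = ≤-from 0≤v (identity u v)
      where
      identity : ∀ u v → u + v ≡ u + v + 0ℚ
      identity = solve-∀ ringℚ

  0<h : 0ℚ < h
  0<h = Q.<-≤-trans 0<u u≤h

  0≤h : 0ℚ Q.≤ h
  0≤h = Q.<⇒≤ 0<h

  h≤suc·h : ∀ k → h Q.≤ suc k · h
  h≤suc·h k = subst (Q._≤ suc k · h) (1-· h) (·-monoˡ {1} {suc k} 0≤h (ℕ.s≤s ℕ.z≤n))

  0<size : ∀ j → 0ℚ < size j
  0<size job₂     = Q.<-≤-trans 0<h (h≤suc·h 1)
  0<size job₄     = Q.<-≤-trans 0<h (h≤suc·h 3)
  0<size (tiny _) = Q.*<* (ℤ.+<+ (ℕ.s≤s ℕ.z≤n))

  2h≤size : ∀ {p} → Long p → 2 · h Q.≤ size p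
  2h≤size long₂ = Q.≤-refl
  2h≤size long₄ = ·-monoˡ {2} {4} 0≤h (ℕ.s≤s (ℕ.s≤s ℕ.z≤n))

  long≢tiny : ∀ {p} → Long p → ∀ j → tiny j ≢ p
  long≢tiny long₂ j ()
  long≢tiny long₄ j ()

  -- The arrival time of the jobs that have not been released so far. It is opaque, as is _·_,
  -- because the normal form of an open sum of rationals (with its gcds) is too large.
  opaque
    horizon : ℚ
    horizon = 7 · h + n · u

    n·u≤horizon : n · u Q.≤ horizon
    n·u≤horizon = ≤-from (·-nonNeg 7 0≤h) (identity (7 · h) (n · u))
      where
      identity : ∀ x y → y + x ≡ (x + y) + 0ℚ
      identity = solve-∀ ringℚ

    7h≤horizon : 7 · h Q.≤ horizon
    7h≤horizon = ≤-from (·-nonNeg n 0≤u) (identity (7 · h) (n · u))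
      where
      identity : ∀ x y → x + y ≡ (x + y) + 0ℚ
      identity = solve-∀ ringℚ

  -- Offline flow of order `h` against an online flow of order `n · u`; with `h` equal to
  -- `suc L · u` the quotient has order `n / L`.
  Outcome : Set
  Outcome = Σ (Instance n) (λ J → Σ (ValidInstance J) (λ v → Σ (NPSchedule J) (λ σ →
    (npFlow σ Q.≤ 15 · h) × (n · u Q.≤ 4 · execFlow (execute A J v)))))

  -- Release times of the tiny jobs when the first B₀ of them arrive together at t₁.
  record Releases (t₁ : ℚ) (r : ℕ → ℚ) : Set where
    field
      mono  : ∀ {j k} → j ≤ k → r j Q.≤ r k
      early : ∀ {j} → j ℕ.< B₀ → r j ≡ t₁
      late  : ∀ {j} → B₀ ≤ j → 7 · h Q.≤ r j

  -- An offline order of the two long jobs that leaves [t₁ , t₁ + h] free for the first burst.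
  record Plan (t₁ : ℚ) : Set where
    field
      s₂ s₄  : ℚ
      0≤t₁   : 0ℚ Q.≤ t₁
      t₁≤7h  : t₁ Q.≤ 7 · h
      0≤s₂   : 0ℚ Q.≤ s₂
      0≤s₄   : 0ℚ Q.≤ s₄
      done₂  : s₂ + 2 · h Q.≤ 7 · h
      done₄  : s₄ + 4 · h Q.≤ 7 · h
      apart  : (s₂ + 2 · h Q.≤ s₄) ⊎ (s₄ + 4 · h Q.≤ s₂)
      avoid₂ : (s₂ + 2 · h Q.≤ t₁) ⊎ (t₁ + h Q.≤ s₂)
      avoid₄ : (s₄ + 4 · h Q.≤ t₁) ⊎ (t₁ + h Q.≤ s₄)

  cutoff-mono : ∀ {f N X} → (∀ {j k} → j ≤ k → f j Q.≤ f k) → (∀ j → f j Q.≤ X) →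
    ∀ {j k} → j ≤ k → cutoff f N X j Q.≤ cutoff f N X k
  cutoff-mono {f} {N} {X} mono f≤X {j} {k} j≤k with k ℕ.<? N | j ℕ.<? N
  ... | yes k<N | _ = subst₂ Q._≤_ (sym (cutoff-< f X (ℕ.≤-<-trans j≤k k<N)))
                        (sym (cutoff-< f X k<N)) (mono j≤k)
  ... | no k≮N | yes j<N = subst₂ Q._≤_ (sym (cutoff-< f X j<N))
                             (sym (cutoff-≥ f X (ℕ.≮⇒≥ k≮N))) (f≤X j)
  ... | no k≮N | no j≮N = Q.≤-reflexive (trans (cutoff-≥ f X (ℕ.≮⇒≥ j≮N))
                            (sym (cutoff-≥ f X (ℕ.≮⇒≥ k≮N))))

  cutoff-≤ : ∀ {f N X} → (∀ j → f j Q.≤ X) → ∀ j → cutoff f N X j Q.≤ X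
  cutoff-≤ {f} {N} {X} f≤X j with j ℕ.<? N
  ... | yes j<N = subst (Q._≤ X) (sym (cutoff-< f X j<N)) (f≤X j)
  ... | no  j≮N = Q.≤-reflexive (cutoff-≥ f X (ℕ.≮⇒≥ j≮N))

  cutoff-releases : ∀ {t₁ r N X} → Releases t₁ r → B₀ ≤ N → (∀ j → r j Q.≤ X) → 7 · h Q.≤ X →
    Releases t₁ (cutoff r N X)
  cutoff-releases {r = r} {N} {X} R B₀≤N r≤X 7h≤X = record
    { mono  = cutoff-mono {N = N} (Releases.mono R) r≤X
    ; early = λ j<B₀ → trans (cutoff-< r X (ℕ.<-≤-trans j<B₀ B₀≤N)) (Releases.early R j<B₀)
    ; late  = late
    }
    where
    late : ∀ {j} → B₀ ≤ j → 7 · h Q.≤ cutoff r N X j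
    late {j} B₀≤j with j ℕ.<? N
    ... | yes j<N = subst (7 · h Q.≤_) (sym (cutoff-< r X j<N)) (Releases.late R B₀≤j)
    ... | no  j≮N = subst (7 · h Q.≤_) (sym (cutoff-≥ r X (ℕ.≮⇒≥ j≮N))) 7h≤X

  -- The offline schedule and lower bounds on the online flow

  module Offline {t₁ r} (plan : Plan t₁) (R : Releases t₁ r) where
    open Plan plan
    open Releases R

    valid : ValidInstance (jobs r)
    valid j = rel≥0 j , 0<size j
      where
      rel≥0 : ∀ j → 0ℚ Q.≤ rel (jobs r) j
      rel≥0 job₂     = Q.≤-refl
      rel≥0 job₄     = Q.≤-refl
      rel≥0 (tiny j) with toℕ j ℕ.<? B₀
      ... | yes j<B₀ = subst (0ℚ Q.≤_) (sym (early j<B₀)) 0≤t₁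
      ... | no  j≮B₀ = Q.≤-trans (·-nonNeg 7 0≤h) (late (ℕ.≮⇒≥ j≮B₀))

    -- Delaying job `j` by its index separates jobs released together, since release times are
    -- monotone, and keeps every flow at most `m`.
    tinyStart : Fin m → ℚ
    tinyStart j = r (toℕ j) + ℕtoℚ (toℕ j)

    r≤tinyStart : ∀ j → r (toℕ j) Q.≤ tinyStart j
    r≤tinyStart j = subst (Q._≤ tinyStart j) (Q.+-identityʳ (r (toℕ j)))
      (Q.+-monoʳ-≤ (r (toℕ j)) (ℕtoℚ-mono {0} {toℕ j} ℕ.z≤n))

    tinyEnd≡ : ∀ j → tinyStart j + 1ℚ ≡ r (toℕ j) + ℕtoℚ (suc (toℕ j))
    tinyEnd≡ j = trans (rearrange (r (toℕ j)) (ℕtoℚ (toℕ j)))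
      (cong (r (toℕ j) +_) (sym (ℕtoℚ-+ 1 (toℕ j))))
      where
      rearrange : ∀ x y → x + y + 1ℚ ≡ x + (1ℚ + y)
      rearrange = solve-∀ ringℚ

    tiny-ordered : ∀ {j k} → toℕ j ℕ.< toℕ k → tinyStart j + 1ℚ Q.≤ tinyStart k
    tiny-ordered {j} j<k = Q.≤-trans (Q.≤-reflexive (tinyEnd≡ j))
      (mono (ℕ.<⇒≤ j<k) ⊕ ℕtoℚ-mono j<k)

    m≤h : ℕtoℚ m Q.≤ h
    m≤h = Q.≤-trans (ℕtoℚ-mono (m≤m² m)) m²≤h
      where
      m≤m² : ∀ m → m ≤ m ℕ.* m
      m≤m² zero    = ℕ.z≤n
      m≤m² (suc m) = ℕ.m≤m*n (suc m) (suc m)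

    -- With `[s, e]` the slot of a long job: the first burst is served within `[t₁, t₁ + h]` because
    -- `m ≤ h`, and all other tiny jobs start at `7h` or later.
    tiny-clear : ∀ {s e} → e Q.≤ 7 · h → (e Q.≤ t₁) ⊎ (t₁ + h Q.≤ s) → ∀ j →
      (e Q.≤ tinyStart j) ⊎ (tinyStart j + 1ℚ Q.≤ s)
    tiny-clear e≤7h avoid j with toℕ j ℕ.<? B₀ | avoid
    ... | no j≮B₀ | _ = inj₁ (Q.≤-trans e≤7h
                          (Q.≤-trans (late (ℕ.≮⇒≥ j≮B₀)) (r≤tinyStart j)))
    ... | yes j<B₀ | inj₁ e≤t₁ = inj₁ (Q.≤-trans e≤t₁
                                   (Q.≤-trans (Q.≤-reflexive (sym (early j<B₀))) (r≤tinyStart j)))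
    ... | yes j<B₀ | inj₂ t₁+h≤s = inj₂ (Q.≤-trans (Q.≤-reflexive (tinyEnd≡ j))
      (Q.≤-trans (Q.≤-reflexive (early j<B₀) ⊕ Q.≤-trans (ℕtoℚ-mono (toℕ<n j)) m≤h) t₁+h≤s))

    starts : Fin n → ℚ
    starts job₂     = s₂
    starts job₄     = s₄
    starts (tiny j) = tinyStart j

    schedule : NPSchedule (jobs r)
    schedule = record { st = starts ; released = rel≤ ; disjoint = disj }
      where
      rel≤ : ∀ j → rel (jobs r) j Q.≤ starts j
      rel≤ job₂     = 0≤s₂
      rel≤ job₄     = 0≤s₄
      rel≤ (tiny j) = r≤tinyStart j
      disj : ∀ j k → ¬ (j ≡ k) →
        (starts j + size j Q.≤ starts k) ⊎ (starts k + size k Q.≤ starts j)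
      disj job₂     job₂     j≢k = contradiction refl j≢k
      disj job₂     job₄     _   = apart
      disj job₂     (tiny k) _   = tiny-clear done₂ avoid₂ k
      disj job₄     job₂     _   = Sum.swap apart
      disj job₄     job₄     j≢k = contradiction refl j≢k
      disj job₄     (tiny k) _   = tiny-clear done₄ avoid₄ k
      disj (tiny j) job₂     _   = Sum.swap (tiny-clear done₂ avoid₂ j)
      disj (tiny j) job₄     _   = Sum.swap (tiny-clear done₄ avoid₄ j)
      disj (tiny j) (tiny k) j≢k with ℕ.<-cmp (toℕ j) (toℕ k)
      ... | tri< j<k _ _ = inj₁ (tiny-ordered {j} {k} j<k)
      ... | tri≈ _ j≡k _ = contradiction (cong (fsuc ∘ fsuc) (toℕ-injective j≡k)) j≢k
      ... | tri> _ _ k<j = inj₂ (tiny-ordered {k} {j} k<j)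

    tinyFlow≤m : ∀ j → tinyStart j + 1ℚ - r (toℕ j) Q.≤ ℕtoℚ m
    tinyFlow≤m j = ≤-from (Q.≤-reflexive (tinyEnd≡ j) ⊕ ℕtoℚ-mono (toℕ<n j))
      (identity (tinyStart j) (r (toℕ j)) (ℕtoℚ m) (ℕtoℚ (suc (toℕ j))))
      where
      identity : ∀ s r m k → (s + 1ℚ - r) + ((r + k) + m) ≡ m + ((s + 1ℚ) + k)
      identity = solve-∀ ringℚ

    opaque
      unfolding _·_
      -- Each long job contributes at most `7h`; the `m` tiny jobs contribute at most `m` each, so
      -- at most `h` together.
      schedule-cheap : npFlow schedule Q.≤ 15 · h
      schedule-cheap = ≤-from (done₂ ⊕ done₄ ⊕ tinies)
        (identity h s₂ s₄ (sumFin m (λ j → tinyStart j + 1ℚ - r (toℕ j))))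
        where
        tinies : sumFin m (λ j → tinyStart j + 1ℚ - r (toℕ j)) Q.≤ h
        tinies = Q.≤-trans (sumFin≤· m tinyFlow≤m) (Q.≤-trans (Q.≤-reflexive (sym (ℕtoℚ-* m m))) m²≤h)
        identity : ∀ h s₂ s₄ S →
          ((s₂ + ℕtoℚ 2 * h - 0ℚ) + ((s₄ + ℕtoℚ 4 * h - 0ℚ) + S)) + (ℕtoℚ 7 * h + ℕtoℚ 7 * h + h)
            ≡ ℕtoℚ 15 * h + ((s₂ + ℕtoℚ 2 * h) + (s₄ + ℕtoℚ 4 * h) + S)
        identity = solve-∀ ringℚ

    exec : Execution (jobs r)
    exec = execute A (jobs r) valid

    tinyFlow : Fin m → ℚ
    tinyFlow j = comp exec (tiny j) - r (toℕ j)

    comp≥rel : ∀ j → rel (jobs r) j Q.≤ comp exec j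
    comp≥rel j = Q.≤-trans (rel≤begun exec j) (Q.<⇒≤ (begun<comp exec j))

    tinyFlow≥0 : ∀ j → 0ℚ Q.≤ tinyFlow j
    tinyFlow≥0 j = 0≤-diff (comp≥rel (tiny j))

    -- Long jobs are released at 0, so the flow of `p` is its completion time; the flow of the other
    -- long job is nonnegative and is dropped.
    execFlow-≥ : ∀ {p x} → Long p → x Q.≤ sumFin m tinyFlow → comp exec p + x Q.≤ execFlow exec
    execFlow-≥ {x = x} long₂ x≤ = ≤-from (x≤ ⊕ comp≥rel job₄)
      (identity (comp exec job₂) (comp exec job₄) x (sumFin m tinyFlow))
      where
      identity : ∀ a b x S → (a + x) + (S + b) ≡ ((a - 0ℚ) + ((b - 0ℚ) + S)) + (x + 0ℚ)
      identity = solve-∀ ringℚ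
    execFlow-≥ {x = x} long₄ x≤ = ≤-from (x≤ ⊕ comp≥rel job₂)
      (identity (comp exec job₂) (comp exec job₄) x (sumFin m tinyFlow))
      where
      identity : ∀ a b x S → (b + x) + (S + a) ≡ ((a - 0ℚ) + ((b - 0ℚ) + S)) + (x + 0ℚ)
      identity = solve-∀ ringℚ

    outcome : n · u Q.≤ 4 · execFlow exec → Outcome
    outcome bad = jobs r , valid , schedule , schedule-cheap , bad

    -- A long job that keeps the machine busy during [t₁ , t₁ + 2h] delays the whole first burst.
    blocked : ∀ {p} → Long p → begun exec p Q.≤ t₁ → t₁ + 2 · h Q.≤ comp exec p → Outcome
    blocked {p} long b≤t₁ t₁+2h≤c = outcome (Q.≤-trans n·u≤ (·-monoʳ 4 enough))
      where
      delayed : ∀ j → toℕ j ℕ.< B₀ → 2 · h Q.≤ tinyFlow j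
      delayed j j<B₀ = ≤-from (t₁+2h≤c ⊕ waits ⊕ Q.≤-reflexive (early j<B₀))
        (identity′ (2 · h) t₁ (comp exec p) (comp exec (tiny j)) (r (toℕ j)))
        where
        waits : comp exec p Q.≤ comp exec (tiny j)
        waits = Q.≤-trans (waits-for exec (long≢tiny long j)
          (subst (begun exec p Q.≤_) (sym (early j<B₀)) b≤t₁)) (Q.<⇒≤ (begun<comp exec (tiny j)))
        identity′ : ∀ x t c d r → x + ((c + d) + t) ≡ (d - r) + ((t + x) + c + r)
        identity′ = solve-∀ ringℚ
      flow≥ : comp exec p + B₀ · 2 · h Q.≤ execFlow exec
      flow≥ = execFlow-≥ long (Q.≤-trans (Q.≤-reflexive (sym (prefixSum-const (2 · h) B₀)))
        (prefixSum≤sumFin (subst (B₀ ≤_) B₀+B≡m (ℕ.m≤m+n B₀ B)) delayed tinyFlow≥0))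
      c≥2h : 2 · h Q.≤ comp exec p
      c≥2h = ≤-from (0≤t₁ ⊕ t₁+2h≤c) (identity′ (2 · h) t₁ (comp exec p))
        where
        identity′ : ∀ x t c → x + (t + c) ≡ c + (0ℚ + (t + x))
        identity′ = solve-∀ ringℚ
      -- The flow is at least `k · h`: `2h` for `p` and `2h` for each of the `B₀` delayed jobs. As
      -- the two halves differ by at most one, `n ≤ suc k`.
      k : ℕ
      k = 2 ℕ.+ (B₀ ℕ.+ B₀)
      n≤1+k : n ≤ suc k
      n≤1+k = ℕ.s≤s (ℕ.s≤s (subst₂ _≤_ B₀+B≡m (ℕ.+-suc B₀ B₀) (ℕ.+-monoʳ-≤ B₀ B≤1+B₀)))
      n≤4k : n ≤ 4 ℕ.* k
      n≤4k = ℕ.≤-trans n≤1+k (ℕ.≤-trans (ℕ.+-monoˡ-≤ k {1} {k} (ℕ.s≤s ℕ.z≤n)) (ℕ.+-monoʳ-≤ k (ℕ.m≤m+n k (2 ℕ.* k))))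
      k·h≡ : k · h ≡ 2 · h + (B₀ · h + B₀ · h)
      k·h≡ = trans (+-· 2 (B₀ ℕ.+ B₀) h) (cong (2 · h +_) (+-· B₀ B₀ h))
      n·u≤ : n · u Q.≤ 4 · (2 · h + (B₀ · h + B₀ · h))
      n·u≤ = Q.≤-trans (·-monoʳ n u≤h) (Q.≤-trans (·-monoˡ 0≤h n≤4k)
        (Q.≤-reflexive (trans (*-· 4 k h) (cong (4 ·_) k·h≡))))
      opaque
        unfolding _·_
        enough : 2 · h + (B₀ · h + B₀ · h) Q.≤ execFlow exec
        enough = ≤-from (c≥2h ⊕ flow≥) (identity h (comp exec p) (ℕtoℚ B₀) (execFlow exec))
          where
          identity : ∀ h c b F → (ℕtoℚ 2 * h + (b * h + b * h)) + (c + F)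
            ≡ F + (ℕtoℚ 2 * h + (c + b * (ℕtoℚ 2 * h)))
          identity = solve-∀ ringℚ

  open Offline

  module _ {t₁} {r r′ : ℕ → ℚ} (plan : Plan t₁) {t₁′} (plan′ : Plan t₁′)
    (R : Releases t₁ r) (R′ : Releases t₁′ r′) where

    same-runs : ∀ {t} → (∀ j → r j < t ⊎ r′ j < t → r j ≡ r′ j) →
      truncateAt t (runs (exec plan R)) ≡ truncateAt t (runs (exec plan′ R′))
    same-runs {t} eq = online A (jobs r) (jobs r′) (valid plan R) (valid plan′ R′) t agree
      where
      agree : AgreeBefore (jobs r) (jobs r′) t
      agree job₂     _      = refl , refl
      agree job₄     _      = refl , refl
      agree (tiny j) before = eq (toℕ j) before , refl

  -- Doubling bursts against an unfinished long job

  module Attack {t₁} (plan : Plan t₁) {p} (long : Long p) where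

    -- After i bursts during the current run of p, N tiny jobs have been released. Job j < N is
    -- known to wait for lb j, and these waiting times and the delay of p add up to g units.
    record State (N i g : ℕ) : Set where
      field
        ρ     : ℕ → ℚ
        R     : Releases t₁ ρ
        τ     : ℚ
        ρ≤τ   : ∀ j → ρ j Q.≤ τ
        7h≤τ  : 7 · h Q.≤ τ
        τ≤M   : τ Q.≤ horizon
        B₀≤N  : B₀ ≤ N

      -- The instance that the algorithm faces: jobs from index `N` on are parked at `horizon` and
      -- can be moved to an earlier date without affecting what happens before that date.
      played : Releases t₁ (cutoff ρ N horizon)
      played = cutoff-releases R B₀≤N (λ j → Q.≤-trans (ρ≤τ j) τ≤M) 7h≤horizon

      c : ℚ
      c = comp (exec plan played) p

      -- Bursts hit the last `h` of the completing run of `p`, at multiples of `u`. That run has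
      -- length at least `2h`, so it is already under way.
      next : ℚ
      next = (c - h) + suc i · u

      field
        lb    : ℕ → ℚ
        τ≤    : τ Q.≤ (c - h) + i · u
        waits : ∀ j → toℕ j ℕ.< N → ρ (toℕ j) + lb (toℕ j) Q.≤ comp (exec plan played) (tiny j)
        -- All waiting claimed so far has elapsed by the next burst, so `comp-≥-transfer` preserves
        -- it when later releases change.
        sofar : ∀ j → j ℕ.< N → ρ j + lb j Q.≤ next
        gain  : 8 · h + g · u Q.≤ c + prefixSum lb N

    module Burst {N i g} (st : State N i g) (room : suc (suc i) · u Q.≤ h)
      (c≤M : State.c st Q.≤ horizon) (b : ℕ) where
      open State st

      N′ : ℕ
      N′ = N ℕ.+ b

      ρ′ : ℕ → ℚ
      ρ′ = cutoff ρ N next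

      next≡ : next ≡ (c - h) + (u + i · u)
      next≡ = cong ((c - h) +_) (suc-· i u)

      τ≤next : τ Q.≤ next
      τ≤next = ≤-from (τ≤ ⊕ 0≤u ⊕ Q.≤-reflexive (sym next≡)) (identity τ c h u (i · u) next)
        where
        identity : ∀ τ c h u x n →
          τ + (((c - h) + x) + u + n) ≡ n + (τ + 0ℚ + ((c - h) + (u + x)))
        identity = solve-∀ ringℚ

      -- `room` counts one interval beyond the new burst: this is the time that the burst has to
      -- wait if the run of `p` goes on.
      next+u≤c : next + u Q.≤ c
      next+u≤c = ≤-from (room ⊕ Q.≤-reflexive (sym (suc-· (suc i) u)))
        (identity c h u (suc i · u) (suc (suc i) · u))
        where
        identity : ∀ c h u x y → ((c - h) + x + u) + (h + y) ≡ c + (y + (u + x))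
        identity = solve-∀ ringℚ

      next≤c : next Q.≤ c
      next≤c = ≤-from (next+u≤c ⊕ 0≤u) (identity next u c)
        where
        identity : ∀ n u c → n + (c + u) ≡ c + (n + u + 0ℚ)
        identity = solve-∀ ringℚ

      next≤M : next Q.≤ horizon
      next≤M = Q.≤-trans next≤c c≤M

      7h≤next : 7 · h Q.≤ next
      7h≤next = Q.≤-trans 7h≤τ τ≤next

      ρ≤next : ∀ j → ρ j Q.≤ next
      ρ≤next j = Q.≤-trans (ρ≤τ j) τ≤next

      R′ : Releases t₁ ρ′
      R′ = cutoff-releases R B₀≤N ρ≤next 7h≤next

      ρ′≤next : ∀ j → ρ′ j Q.≤ next
      ρ′≤next = cutoff-≤ {N = N} ρ≤next

      B₀≤N′ : B₀ ≤ N′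
      B₀≤N′ = ℕ.≤-trans B₀≤N (ℕ.m≤m+n N b)

      played′ : Releases t₁ (cutoff ρ′ N′ horizon)
      played′ = cutoff-releases R′ B₀≤N′ (λ j → Q.≤-trans (ρ′≤next j) next≤M) 7h≤horizon

      E E′ : Execution _
      E  = exec plan played
      E′ = exec plan played′

      -- Jobs below `N` keep their dates; all others are released at `next` or `horizon` in either
      -- instance, hence not before `next`.
      released-alike : ∀ j → cutoff ρ N horizon j < next ⊎ cutoff ρ′ N′ horizon j < next →
        cutoff ρ N horizon j ≡ cutoff ρ′ N′ horizon j
      released-alike j before = [ alike , ⊥-elim ∘ late before ]′ (ℕ.<-≤-connex j N)
        where
        alike : j ℕ.< N → cutoff ρ N horizon j ≡ cutoff ρ′ N′ horizon j
        alike j<N = trans (cutoff-< ρ horizon j<N) (sym (trans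
          (cutoff-< ρ′ horizon (ℕ.<-≤-trans j<N (ℕ.m≤m+n N b))) (cutoff-< ρ next j<N)))
        late : cutoff ρ N horizon j < next ⊎ cutoff ρ′ N′ horizon j < next → ¬ (N ≤ j)
        late (inj₁ r<) N≤j = ≤⇒≯ next≤M (subst (_< next) (cutoff-≥ ρ horizon N≤j) r<)
        late (inj₂ r<) N≤j =
          [ (λ j<N′ → Q.<-irrefl (trans (cutoff-< ρ′ horizon j<N′) (cutoff-≥ ρ next N≤j)) r<)
          , (λ N′≤j → ≤⇒≯ next≤M (subst (_< next) (cutoff-≥ ρ′ horizon N′≤j) r<))
          ]′ (ℕ.<-≤-connex j N′)

      module I = Indistinguishable E E′ (λ _ → refl) next (same-runs plan plan played played′ released-alike)

      c′ : ℚ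
      c′ = comp E′ p

      opaque
        unfolding _·_
        begun<next : begun E p < next
        begun<next = Q.≤-<-trans (≤-from (2h≤size long ⊕ 0≤h) (identity c h (size p))) c-h<next
          where
          identity : ∀ c h s → (c - s) + (s + h) ≡ (c - h) + (ℕtoℚ 2 * h + 0ℚ)
          identity = solve-∀ ringℚ
          c-h<next : c - h < next
          c-h<next = subst₂ _<_ (Q.+-identityʳ (c - h)) (sym next≡)
            (Q.+-monoʳ-< (c - h) (Q.+-mono-<-≤ 0<u (·-nonNeg i 0≤u)))

      -- The waiting time v of the new jobs is u if p keeps running and 0 if its run was killed.
      module _ (v : ℚ) where

        lb′ : ℕ → ℚ
        lb′ = cutoff lb N v

        ρ′+lb′-< : ∀ {j} → j ℕ.< N → ρ′ j + lb′ j ≡ ρ j + lb j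
        ρ′+lb′-< j<N = cong₂ _+_ (cutoff-< ρ next j<N) (cutoff-< lb v j<N)

        ρ′+lb′-≥ : ∀ {j} → N ≤ j → ρ′ j + lb′ j ≡ next + v
        ρ′+lb′-≥ N≤j = cong₂ _+_ (cutoff-≥ ρ next N≤j) (cutoff-≥ lb v N≤j)

        waits′ : (∀ j → cutoff ρ′ N′ horizon (toℕ j) ≡ next → next + v Q.≤ comp E′ (tiny j)) →
          ∀ j → toℕ j ℕ.< N′ → ρ′ (toℕ j) + lb′ (toℕ j) Q.≤ comp E′ (tiny j)
        waits′ new j j<N′ =
          [ (λ j<N → subst (Q._≤ comp E′ (tiny j)) (sym (ρ′+lb′-< j<N))
                       (I.comp-≥-transfer (sofar (toℕ j) j<N) (waits j j<N)))
          , (λ N≤j → subst (Q._≤ comp E′ (tiny j)) (sym (ρ′+lb′-≥ N≤j))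
                       (new j (trans (cutoff-< ρ′ horizon j<N′) (cutoff-≥ ρ next N≤j))))
          ]′ (ℕ.<-≤-connex (toℕ j) N)

        sofar′ : ∀ {d} → next Q.≤ d → next + v Q.≤ d → ∀ j → j ℕ.< N′ → ρ′ j + lb′ j Q.≤ d
        sofar′ {d} next≤d next+v≤d j _ =
          [ (λ j<N → subst (Q._≤ d) (sym (ρ′+lb′-< j<N)) (Q.≤-trans (sofar j j<N) next≤d))
          , (λ N≤j → subst (Q._≤ d) (sym (ρ′+lb′-≥ N≤j)) next+v≤d)
          ]′ (ℕ.<-≤-connex j N)

        prefixSum-lb′ : prefixSum lb′ N′ ≡ prefixSum lb N + b · v
        prefixSum-lb′ = prefixSum-cutoff lb N v b

        state′ : ∀ {i′ g′} → next Q.≤ (c′ - h) + i′ · u → next + v Q.≤ (c′ - h) + suc i′ · u →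
          (∀ j → cutoff ρ′ N′ horizon (toℕ j) ≡ next → next + v Q.≤ comp E′ (tiny j)) →
          8 · h + g′ · u Q.≤ c′ + (prefixSum lb N + b · v) → State N′ i′ g′
        state′ {i′} {g′} next≤ next+v≤ new gain′ = record
          { ρ = ρ′ ; R = R′ ; τ = next ; ρ≤τ = ρ′≤next ; 7h≤τ = 7h≤next ; τ≤M = next≤M
          ; B₀≤N = B₀≤N′ ; lb = lb′ ; τ≤ = next≤ ; waits = waits′ new
          ; sofar = sofar′ (Q.≤-trans next≤ later) next+v≤
          ; gain = subst (λ S → 8 · h + g′ · u Q.≤ c′ + S) (sym prefixSum-lb′) gain′
          }
          where
          later : (c′ - h) + i′ · u Q.≤ (c′ - h) + suc i′ · u
          later = Q.+-monoʳ-≤ (c′ - h) (·-monoˡ {i′} {suc i′} 0≤u (ℕ.n≤1+n i′))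

      -- Each of the `b` new jobs finds `p` running and waits until `c`, which is at least
      -- `next + u`, so it contributes one unit of gain.
      continued : c′ ≡ c → State N′ (suc i) (g ℕ.+ b)
      continued c′≡c = state′ u next≤ next+u≤ new gain′
        where
        c≤c′ : c Q.≤ c′
        c≤c′ = Q.≤-reflexive (sym c′≡c)
        next≤ : next Q.≤ (c′ - h) + suc i · u
        next≤ = Q.+-monoˡ-≤ (suc i · u) (Q.+-monoˡ-≤ (Q.- h) c≤c′)
        next+u≤ : next + u Q.≤ (c′ - h) + suc (suc i) · u
        next+u≤ = ≤-from (c≤c′ ⊕ Q.≤-reflexive (sym (suc-· (suc i) u)))
          (identity c c′ h u (suc i · u) (suc (suc i) · u))
          where
          identity : ∀ c c′ h u x y → ((c - h) + x + u) + (c′ + y) ≡ ((c′ - h) + y) + (c + (u + x))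
          identity = solve-∀ ringℚ
        new : ∀ j → cutoff ρ′ N′ horizon (toℕ j) ≡ next → next + u Q.≤ comp E′ (tiny j)
        new j r≡ = Q.≤-trans next+u≤c (Q.≤-trans c≤c′ (Q.≤-trans
          (waits-for E′ (long≢tiny long j) (subst (begun E′ p Q.≤_) (sym r≡)
            (subst (λ x → x - size p Q.≤ next) (sym c′≡c) (Q.<⇒≤ begun<next))))
          (Q.<⇒≤ (begun<comp E′ (tiny j)))))
        gain′ : 8 · h + (g ℕ.+ b) · u Q.≤ c′ + (prefixSum lb N + b · u)
        gain′ = ≤-from (gain ⊕ c≤c′ ⊕ Q.≤-reflexive (+-· g b u))
          (identity (8 · h) (g · u) (b · u) ((g ℕ.+ b) · u) c c′ (prefixSum lb N))
          where
          identity : ∀ x y z w c c′ S → (x + w) + ((c + S) + c′ + (y + z))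
            ≡ (c′ + (S + z)) + ((x + y) + c + w)
          identity = solve-∀ ringℚ

      opaque
        unfolding _·_
        -- The new run of `p` starts at `next` or later, so `c′` is at least `next + h`, that is
        -- `c + suc i · u`: one unit of gain or more. Also `next` lies before the last `h` of the
        -- new run, so the burst count restarts at 0.
        killed : next Q.≤ begun E′ p → State N′ 0 (suc g)
        killed fresh = state′ 0ℚ next≤ next+0≤ new gain′
          where
          next+h≤c′ : next + h Q.≤ c′
          next+h≤c′ = ≤-from (fresh ⊕ 2h≤size long ⊕ 0≤h) (identity next h c′ (size p))
            where
            identity : ∀ n h c s → (n + h) + ((c - s) + s + h) ≡ c + (n + ℕtoℚ 2 * h + 0ℚ)
            identity = solve-∀ ringℚ
          next≤ : next Q.≤ (c′ - h) + 0 · u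
          next≤ = ≤-from next+h≤c′ (identity next h c′ u)
            where
            identity : ∀ n h c u → n + c ≡ ((c - h) + ℕtoℚ 0 * u) + (n + h)
            identity = solve-∀ ringℚ
          next+0≤ : next + 0ℚ Q.≤ (c′ - h) + 1 · u
          next+0≤ = ≤-from (next≤ ⊕ 0≤u) (identity next ((c′ - h)) u)
            where
            identity : ∀ n d u → (n + 0ℚ) + ((d + ℕtoℚ 0 * u) + u) ≡ (d + ℕtoℚ 1 * u) + (n + 0ℚ)
            identity = solve-∀ ringℚ
          new : ∀ j → cutoff ρ′ N′ horizon (toℕ j) ≡ next → next + 0ℚ Q.≤ comp E′ (tiny j)
          new j r≡ = Q.≤-trans (Q.≤-reflexive (trans (Q.+-identityʳ next) (sym r≡)))
            (comp≥rel plan played′ (tiny j))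
          gain′ : 8 · h + suc g · u Q.≤ c′ + (prefixSum lb N + b · 0ℚ)
          gain′ = ≤-from (gain ⊕ next+h≤c′ ⊕ ·-nonNeg i 0≤u ⊕ Q.≤-reflexive (suc-· g u)
                            ⊕ Q.≤-reflexive (sym next≡))
            (identity (8 · h) (g · u) (suc g · u) u (i · u) c h c′ next (prefixSum lb N) (ℕtoℚ b))
            where
            identity : ∀ x y w u z c h c′ n S b →
              (x + w) + ((c + S) + c′ + z + (u + y) + n)
                ≡ (c′ + (S + b * 0ℚ)) + ((x + y) + (n + h) + 0ℚ + w + ((c - h) + (u + z)))
            identity = solve-∀ ringℚ

      advance : State N′ (suc i) (g ℕ.+ b) ⊎ State N′ 0 (suc g)
      advance = Sum.map continued killed (I.same-run-or-fresh begun<next next≤c)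

    opaque
      unfolding _·_
      -- The flow of `p` alone is at least `horizon`, hence at least `n · u`. In the opposite case
      -- the next burst comes no later than the parked jobs.
      timeout : ∀ {N i g} (st : State N i g) → horizon Q.≤ State.c st → Outcome
      timeout st M≤c = outcome plan (State.played st) (Q.≤-trans n·u≤F (≤-from
        (F≥0 ⊕ F≥0 ⊕ F≥0) (identity F)))
        where
        open State st
        F : ℚ
        F = execFlow (exec plan played)
        n·u≤F : n · u Q.≤ F
        n·u≤F = Q.≤-trans n·u≤horizon (Q.≤-trans M≤c (Q.≤-trans
          (Q.≤-reflexive (sym (Q.+-identityʳ c)))
          (execFlow-≥ plan played long (sumFin-≥0 m (tinyFlow≥0 plan played)))))
        F≥0 : 0ℚ Q.≤ F
        F≥0 = Q.≤-trans (·-nonNeg n 0≤u) n·u≤F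
        identity : ∀ F → F + (F + F + F) ≡ ℕtoℚ 4 * F + (0ℚ + 0ℚ + 0ℚ)
        identity = solve-∀ ringℚ

    -- `B₀ ≤ B ≤ g + g` gives `n ≤ 4 * suc g`. Of the `suc g` units needed, `g` are the gain and one
    -- is taken from the baseline `8h`.
    exhausted : ∀ {N i g} → State N i g → N ≤ m → B ≤ g ℕ.+ g → Outcome
    exhausted {N} {i} {g} st N≤m B≤2g = outcome plan played (Q.≤-trans n·u≤ (·-monoʳ 4 enough))
      where
      open State st
      F : ℚ
      F = execFlow (exec plan played)
      delayed : ∀ j → toℕ j ℕ.< N → lb (toℕ j) Q.≤ tinyFlow plan played j
      delayed j j<N = ≤-from (waits j j<N ⊕ Q.≤-reflexive (cutoff-< ρ horizon j<N))
        (identity (lb (toℕ j)) (ρ (toℕ j)) (comp (exec plan played) (tiny j))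
          (cutoff ρ N horizon (toℕ j)))
        where
        identity : ∀ l r d r′ → l + (d + r) ≡ (d - r′) + ((r + l) + r′)
        identity = solve-∀ ringℚ
      opaque
        unfolding _·_
        enough : u + g · u Q.≤ F
        enough = ≤-from (execFlow-≥ plan played long
                          (prefixSum≤sumFin N≤m delayed (tinyFlow≥0 plan played))
                          ⊕ gain ⊕ u≤h ⊕ ·-nonNeg 7 0≤h)
          (identity u h (g · u) F c (prefixSum lb N))
          where
          identity : ∀ u h x F c S → (u + x) + (F + (c + S) + h + ℕtoℚ 7 * h)
            ≡ F + ((c + S) + (ℕtoℚ 8 * h + x) + u + 0ℚ)
          identity = solve-∀ ringℚ

      n≤ : n ≤ 4 ℕ.* suc g
      n≤ = begin
        2 ℕ.+ m              ≡⟨ cong (2 ℕ.+_) B₀+B≡m ⟨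
        2 ℕ.+ (B₀ ℕ.+ B)     ≤⟨ ℕ.+-monoʳ-≤ 2 (ℕ.+-mono-≤ (ℕ.≤-trans B₀≤B B≤2g) B≤2g) ⟩
        2 ℕ.+ (2g ℕ.+ 2g)    ≤⟨ ℕ.m≤m+n _ 2 ⟩
        2 ℕ.+ (2g ℕ.+ 2g) ℕ.+ 2 ≡⟨ regroup g ⟩
        4 ℕ.* suc g          ∎
        where
        open ℕ.≤-Reasoning
        2g : ℕ
        2g = g ℕ.+ g
        regroup : ∀ g → 2 ℕ.+ ((g ℕ.+ g) ℕ.+ (g ℕ.+ g)) ℕ.+ 2 ≡ 4 ℕ.* suc g
        regroup = ℕ-solve-∀
      n·u≤ : n · u Q.≤ 4 · (u + g · u)
      n·u≤ = Q.≤-trans (·-monoˡ 0≤u n≤)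
        (Q.≤-reflexive (trans (*-· 4 (suc g) u) (cong (4 ·_) (suc-· g u))))

    -- Bursts double in size while the run of p survives, so the tiny jobs used are always at
    -- most twice the gain, and a run cannot see more than L bursts.
    attack : ∀ fuel N i g → State (B₀ ℕ.+ N) i g → N ≤ B → B ≤ N ℕ.+ fuel →
      N ℕ.+ 2 ℕ.^ i ≤ suc (g ℕ.+ g) → 2 ℕ.^ i ≤ suc N → Outcome
    attack fuel N i g st N≤B enough used k≤1+N =
      -- `N` counts only the jobs of the later bursts. If a burst of size `2 ^ i` does not fit any
      -- more, `used` yields `B < suc (g + g)`.
      [ (λ over → exhausted st (subst (B₀ ℕ.+ N ≤_) B₀+B≡m (ℕ.+-monoʳ-≤ B₀ N≤B))
                    (ℕ.s≤s⁻¹ (ℕ.≤-trans over used)))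
      , (λ fits → [ next-burst fuel enough fits , timeout st ]′ (Q.≤-total (State.c st) horizon))
      ]′ (ℕ.<-≤-connex B (N ℕ.+ k))
      where
      k : ℕ
      k = 2 ℕ.^ i
      open ℕ.≤-Reasoning
      N<N+k : N ℕ.< N ℕ.+ k
      N<N+k = ℕ.m<m+n N (ℕ.m^n>0 2 i)
      2k≤ : 2 ℕ.* k ≤ suc (N ℕ.+ k)
      2k≤ = begin
        2 ℕ.* k              ≡⟨ cong (k ℕ.+_) (ℕ.+-identityʳ k) ⟩
        k ℕ.+ k              ≤⟨ ℕ.+-monoˡ-≤ k k≤1+N ⟩
        suc (N ℕ.+ k)        ∎
      -- The invariant charges the next burst in advance. A burst of size `k` that waits raises the
      -- right side by `2k`, the size of its successor; a kill raises it only by 2, but then the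
      -- successor has size 1.
      used-continued : N ℕ.+ k ℕ.+ 2 ℕ.* k ≤ suc ((g ℕ.+ k) ℕ.+ (g ℕ.+ k))
      used-continued = begin
        N ℕ.+ k ℕ.+ 2 ℕ.* k                ≤⟨ ℕ.+-monoˡ-≤ (2 ℕ.* k) used ⟩
        suc (g ℕ.+ g) ℕ.+ 2 ℕ.* k          ≡⟨ regroup g k ⟩
        suc ((g ℕ.+ k) ℕ.+ (g ℕ.+ k))      ∎
        where
        regroup : ∀ g k → suc (g ℕ.+ g) ℕ.+ 2 ℕ.* k ≡ suc ((g ℕ.+ k) ℕ.+ (g ℕ.+ k))
        regroup = ℕ-solve-∀
      used-killed : N ℕ.+ k ℕ.+ 1 ≤ suc (suc g ℕ.+ suc g)
      used-killed = begin
        N ℕ.+ k ℕ.+ 1              ≤⟨ ℕ.+-monoˡ-≤ 1 used ⟩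
        suc (g ℕ.+ g) ℕ.+ 1        ≤⟨ ℕ.n≤1+n (suc (g ℕ.+ g) ℕ.+ 1) ⟩
        suc (suc (g ℕ.+ g) ℕ.+ 1)  ≡⟨ regroup g ⟩
        suc (suc g ℕ.+ suc g)      ∎
        where
        regroup : ∀ g → suc (suc (g ℕ.+ g) ℕ.+ 1) ≡ suc (suc g ℕ.+ suc g)
        regroup = ℕ-solve-∀
      next-burst : ∀ fuel → B ≤ N ℕ.+ fuel → N ℕ.+ k ≤ B → State.c st Q.≤ horizon → Outcome
      -- Every burst uses at least one of the `B` jobs, so fuel `B` never runs out while a burst
      -- fits.
      next-burst zero       enough fits c≤M =
        contradiction (ℕ.≤-trans fits (subst (B ≤_) (ℕ.+-identityʳ N) enough)) (ℕ.<⇒≱ N<N+k)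
      next-burst (suc fuel) enough fits c≤M =
        [ (λ st′ → attack fuel (N ℕ.+ k) (suc i) (g ℕ.+ k)
            (subst (λ N → State N (suc i) (g ℕ.+ k)) (ℕ.+-assoc B₀ N k) st′)
            fits enough′ used-continued 2k≤)
        , (λ st′ → attack fuel (N ℕ.+ k) 0 (suc g)
            (subst (λ N → State N 0 (suc g)) (ℕ.+-assoc B₀ N k) st′)
            fits enough′ used-killed (ℕ.s≤s ℕ.z≤n))
        ]′ (Burst.advance st room c≤M k)
        where
        2^≤n : 2 ℕ.^ suc i ≤ n
        2^≤n = begin
          2 ℕ.* k            ≤⟨ 2k≤ ⟩
          suc (N ℕ.+ k)      ≤⟨ ℕ.s≤s fits ⟩
          suc B              ≤⟨ ℕ.s≤s (ℕ.m≤n+m B B₀) ⟩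
          suc (B₀ ℕ.+ B)     ≡⟨ cong suc B₀+B≡m ⟩
          suc m              ≤⟨ ℕ.n≤1+n (suc m) ⟩
          n                  ∎
        -- The invariant `2 ^ i ≤ suc N` gives `suc i ≤ L`; the interval after the burst is the
        -- reason for `suc L` in `window`.
        room : suc (suc i) · u Q.≤ h
        room = Q.≤-trans (·-monoˡ {suc (suc i)} {suc L} 0≤u (ℕ.s≤s (2^≤⇒≤L (suc i) 2^≤n))) window
        enough′ : B ≤ N ℕ.+ k ℕ.+ fuel
        enough′ = begin
          B                  ≤⟨ enough ⟩
          N ℕ.+ suc fuel     ≡⟨ ℕ.+-suc N fuel ⟩
          suc N ℕ.+ fuel     ≤⟨ ℕ.+-monoˡ-≤ fuel N<N+k ⟩
          N ℕ.+ k ℕ.+ fuel   ∎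

  -- The first burst and the opening cases

  t₁≤release : ∀ {t₁ r} → Plan t₁ → Releases t₁ r → ∀ j → t₁ Q.≤ r j
  t₁≤release plan R j =
    [ (λ j<B₀ → Q.≤-reflexive (sym (Releases.early R j<B₀)))
    , (λ B₀≤j → Q.≤-trans (Plan.t₁≤7h plan) (Releases.late R B₀≤j))
    ]′ (ℕ.<-≤-connex j B₀)

  module Opening {t₁} (plan : Plan t₁) where

    -- The value `7h` from index `B₀` on meets `Releases.late`; in the instance played, `opening`,
    -- these jobs are parked at `horizon`.
    ρ₀ : ℕ → ℚ
    ρ₀ = cutoff (const t₁) B₀ (7 · h)

    ρ₀≤7h : ∀ j → ρ₀ j Q.≤ 7 · h
    ρ₀≤7h = cutoff-≤ {N = B₀} (λ _ → Plan.t₁≤7h plan)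

    R₀ : Releases t₁ ρ₀
    R₀ = record
      { mono  = cutoff-mono {N = B₀} (λ _ → Q.≤-refl) (λ _ → Plan.t₁≤7h plan)
      ; early = cutoff-< (const t₁) (7 · h)
      ; late  = λ B₀≤j → Q.≤-reflexive (sym (cutoff-≥ (const t₁) (7 · h) B₀≤j))
      }

    opening : Releases t₁ (cutoff ρ₀ B₀ horizon)
    opening = cutoff-releases R₀ ℕ.≤-refl (λ j → Q.≤-trans (ρ₀≤7h j) 7h≤horizon) 7h≤horizon

    E₀ : Execution _
    E₀ = exec plan opening

    -- The last `h` of the run of `p` begins at `7h` or later, when the offline schedule is done
    -- with both long jobs, so every burst can be served offline at once.
    behind : ∀ {p} → Long p → 8 · h Q.≤ comp E₀ p → Outcome
    behind {p} long 8h≤c = attack B 0 0 0 (subst (λ N → State N 0 0) (sym (ℕ.+-identityʳ B₀)) initial)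
      ℕ.z≤n ℕ.≤-refl ℕ.≤-refl ℕ.≤-refl
      where
      open Attack plan long
      c₀ : ℚ
      c₀ = comp E₀ p
      opaque
        unfolding _·_
        7h≤ : ∀ i → 7 · h Q.≤ (c₀ - h) + i · u
        7h≤ i = ≤-from (8h≤c ⊕ ·-nonNeg i 0≤u) (identity h c₀ (i · u))
          where
          identity : ∀ h c x → ℕtoℚ 7 * h + (c + x) ≡ ((c - h) + x) + (ℕtoℚ 8 * h + 0ℚ)
          identity = solve-∀ ringℚ
        gain₀ : 8 · h + 0 · u Q.≤ c₀ + prefixSum (const 0ℚ) B₀
        gain₀ = ≤-from (8h≤c ⊕ Q.≤-reflexive (sym (trans (prefixSum-const 0ℚ B₀) (·-0 B₀))))
          (identity (8 · h) u c₀ (prefixSum (const 0ℚ) B₀))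
          where
          identity : ∀ x u c S → (x + ℕtoℚ 0 * u) + (c + S) ≡ (c + S) + (x + 0ℚ)
          identity = solve-∀ ringℚ
      waits₀ : ∀ j → toℕ j ℕ.< B₀ → ρ₀ (toℕ j) + 0ℚ Q.≤ comp E₀ (tiny j)
      waits₀ j j<B₀ = Q.≤-trans (Q.≤-reflexive
        (trans (Q.+-identityʳ (ρ₀ (toℕ j))) (sym (cutoff-< ρ₀ horizon j<B₀))))
        (comp≥rel plan opening (tiny j))
      initial : State B₀ 0 0
      initial = record
        { ρ = ρ₀ ; R = R₀ ; τ = 7 · h ; ρ≤τ = ρ₀≤7h ; 7h≤τ = Q.≤-refl ; τ≤M = 7h≤horizon
        ; B₀≤N = ℕ.≤-refl ; lb = const 0ℚ ; τ≤ = 7h≤ 0 ; waits = waits₀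
        ; sofar = λ j _ → Q.≤-trans (Q.≤-reflexive (Q.+-identityʳ (ρ₀ j)))
                            (Q.≤-trans (ρ₀≤7h j) (7h≤ 1))
        ; gain = gain₀
        }

  +-·h : ∀ a b → a · h + b · h Q.≤ (a ℕ.+ b) · h
  +-·h a b = Q.≤-reflexive (sym (+-· a b h))

  l·h≤k·h : ∀ {l k} → l ≤ k → l · h Q.≤ k · h
  l·h≤k·h = ·-monoˡ 0≤h

  -- The shorter long job ends exactly when the burst arrives, and the longer one follows the burst;
  -- `plan₄` reverses the order.
  plan₂ : Plan (2 · h)
  plan₂ = record
    { s₂     = 0ℚ
    ; s₄     = 3 · h
    ; 0≤t₁   = ·-nonNeg 2 0≤h
    ; t₁≤7h  = l·h≤k·h (ℕ.m≤m+n 2 5)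
    ; 0≤s₂   = Q.≤-refl
    ; 0≤s₄   = ·-nonNeg 3 0≤h
    ; done₂  = Q.≤-trans (Q.≤-reflexive (Q.+-identityˡ (2 · h))) (l·h≤k·h (ℕ.m≤m+n 2 5))
    ; done₄  = +-·h 3 4
    ; apart  = inj₁ (Q.≤-trans (Q.≤-reflexive (Q.+-identityˡ (2 · h))) (l·h≤k·h (ℕ.m≤m+n 2 1)))
    ; avoid₂ = inj₁ (Q.≤-reflexive (Q.+-identityˡ (2 · h)))
    ; avoid₄ = inj₂ (Q.≤-trans (Q.+-monoʳ-≤ (2 · h) (h≤suc·h 0)) (+-·h 2 1))
    }

  plan₄ : Plan (4 · h)
  plan₄ = record
    { s₂     = 5 · h
    ; s₄     = 0ℚ
    ; 0≤t₁   = ·-nonNeg 4 0≤h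
    ; t₁≤7h  = l·h≤k·h (ℕ.m≤m+n 4 3)
    ; 0≤s₂   = ·-nonNeg 5 0≤h
    ; 0≤s₄   = Q.≤-refl
    ; done₂  = +-·h 5 2
    ; done₄  = Q.≤-trans (Q.≤-reflexive (Q.+-identityˡ (4 · h))) (l·h≤k·h (ℕ.m≤m+n 4 3))
    ; apart  = inj₂ (Q.≤-trans (Q.≤-reflexive (Q.+-identityˡ (4 · h))) (l·h≤k·h (ℕ.m≤m+n 4 1)))
    ; avoid₂ = inj₂ (Q.≤-trans (Q.+-monoʳ-≤ (4 · h) (h≤suc·h 0)) (+-·h 4 1))
    ; avoid₄ = inj₁ (Q.≤-reflexive (Q.+-identityˡ (4 · h)))
    }

  open Opening using (opening; E₀; behind)

  comp-≥ : ∀ {r} (E : Execution (jobs r)) {a p b} → a · h Q.≤ begun E p → b · h Q.≤ size p →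
    (a ℕ.+ b) · h Q.≤ comp E p
  comp-≥ E {a} {p} {b} a≤ b≤ = Q.≤-trans (Q.≤-reflexive (+-· a b h))
    (Q.≤-trans (a≤ ⊕ b≤) (Q.≤-reflexive (sym (comp≡begun+proc E p))))

  0·h≤begun : ∀ {r} (E : Execution (jobs r)) {p} → Long p → 0 · h Q.≤ begun E p
  0·h≤begun E long₂ = Q.≤-trans (Q.≤-reflexive (0-· h)) (rel≤begun E job₂)
  0·h≤begun E long₄ = Q.≤-trans (Q.≤-reflexive (0-· h)) (rel≤begun E job₄)

  -- All `6h` of long work is done after `2h`, so whichever long job comes last completes at `8h` or
  -- later.
  both-fresh : 2 · h Q.≤ begun (E₀ plan₂) job₂ → 2 · h Q.≤ begun (E₀ plan₂) job₄ → Outcome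
  both-fresh fresh₂ fresh₄ = order (runs-comparable E (completes E job₂) (completes E job₄))
    where
    E : Execution _
    E = E₀ plan₂
    order : (fullRun E job₂ ≡ fullRun E job₄) ⊎ (comp E job₂ Q.≤ begun E job₄)
      ⊎ (comp E job₄ Q.≤ begun E job₂) → Outcome
    order (inj₁ ())
    order (inj₂ (inj₁ c₂≤b₄)) = behind plan₂ long₄ (comp-≥ E {4} {job₄} {4}
      (Q.≤-trans (comp-≥ E {2} {job₂} {2} fresh₂ Q.≤-refl) c₂≤b₄) Q.≤-refl)
    order (inj₂ (inj₂ c₄≤b₂)) = behind plan₂ long₂ (comp-≥ E {6} {job₂} {2}
      (Q.≤-trans (comp-≥ E {2} {job₄} {4} fresh₄ Q.≤-refl) c₄≤b₂) Q.≤-refl)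

  -- If the shorter long job runs across time 2h when the first burst comes then, it also does so
  -- when the first burst comes at 4h, so that the longer one starts after 2h.
  first-is-short : begun (E₀ plan₂) job₂ < 2 · h → Outcome
  first-is-short b₂<2h =
    -- The longer job begins at `2h` or later, so it completes no earlier than `6h`. Begun by `4h`,
    -- it blocks the burst for `2h`; begun later, it is not complete before `8h`.
    [ (λ b₄≤4h → blocked plan₄ (opening plan₄) long₄ b₄≤4h
        (Q.≤-trans (+-·h 4 2) (comp-≥ E {2} {job₄} {4} 2h≤b₄ Q.≤-refl)))
    , (λ 4h≤b₄ → behind plan₄ long₄ (comp-≥ E {4} {job₄} {4} 4h≤b₄ Q.≤-refl))
    ]′ (Q.≤-total (begun E job₄) (4 · h))
    where
    E : Execution _
    E = E₀ plan₄
    quiet : ∀ j → cutoff (Opening.ρ₀ plan₄) B₀ horizon j < 2 · h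
      ⊎ cutoff (Opening.ρ₀ plan₂) B₀ horizon j < 2 · h →
      cutoff (Opening.ρ₀ plan₄) B₀ horizon j ≡ cutoff (Opening.ρ₀ plan₂) B₀ horizon j
    quiet j (inj₁ r<) = contradiction r< (≤⇒≯ (Q.≤-trans (l·h≤k·h (ℕ.m≤m+n 2 2))
                          (t₁≤release plan₄ (opening plan₄) j)))
    quiet j (inj₂ r<) = contradiction r< (≤⇒≯ (t₁≤release plan₂ (opening plan₂) j))
    module I = Indistinguishable E (E₀ plan₂) (λ _ → refl) (2 · h)
      (same-runs plan₄ plan₂ (opening plan₄) (opening plan₂) quiet)
    2h≤b₄ : 2 · h Q.≤ begun E job₄
    2h≤b₄ = I.busy-transfer (λ ()) b₂<2h
      (comp-≥ (E₀ plan₂) {0} {job₂} {2} (0·h≤begun (E₀ plan₂) long₂) Q.≤-refl)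
      (Q.≤-trans (l·h≤k·h (ℕ.m≤m+n 2 2)) (comp-≥ E {0} {job₄} {4} (0·h≤begun E long₄) Q.≤-refl))

  -- Let the first burst come at `2h`. If the completing run of the longer job has begun by then, it
  -- lasts until `4h` at least and blocks the burst. Otherwise the shorter job decides whether to
  -- keep this date or to move the burst to `4h`.
  lower-bound : Outcome
  lower-bound =
    [ (λ b₄≤2h → blocked plan₂ (opening plan₂) long₄ b₄≤2h
        (Q.≤-trans (+-·h 2 2) (comp-≥ E {0} {job₄} {4} (0·h≤begun E long₄) Q.≤-refl)))
    , (λ 2h≤b₄ → [ (λ 2h≤b₂ → both-fresh 2h≤b₂ 2h≤b₄)
                 , first-is-short ]′ (≤-<-connex (2 · h) (begun E job₂)))
    ]′ (Q.≤-total (begun E job₄) (2 · h))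
    where
    E : Execution _
    E = E₀ plan₂

-- From the adversary to the competitive ratio

opaque
  unfolding _·_

  -- Since `1 ≤ L`, `suc L` is at most `2L` and `F` at most `30 · L · u`. The constant is `1 / 120`
  -- because `120 = 30 * 4`, with the 4 from the online bound.
  ratio-bound : ∀ {n L u F G} → 1 ≤ L → 0ℚ Q.≤ u → F Q.≤ 15 · suc L · u → n · u Q.≤ 4 · G →
    (ℤ.+ 1 Q./ 120) * ℕtoℚ n * F Q.≤ G * ℕtoℚ L
  ratio-bound {n} {L} {u} {F} {G} 1≤L 0≤u F≤ nu≤ = begin
    c * ℕtoℚ n * F                                ≤⟨ Q.*-monoˡ-≤-nonNeg (c * ℕtoℚ n) {{cn≥0}} F≤30Lu ⟩
    c * ℕtoℚ n * (15 · (L · u + L · u))           ≡⟨ identity₁ (ℕtoℚ n) (ℕtoℚ L) u ⟩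
    L · ((ℤ.+ 1 Q./ 4) * (n · u))                 ≤⟨ ·-monoʳ L (Q.*-monoˡ-≤-nonNeg (ℤ.+ 1 Q./ 4) nu≤) ⟩
    L · ((ℤ.+ 1 Q./ 4) * (4 · G))                 ≡⟨ identity₂ (ℕtoℚ L) G ⟩
    G * ℕtoℚ L                                    ∎
    where
    open Q.≤-Reasoning
    c : ℚ
    c = ℤ.+ 1 Q./ 120
    cn≥0 : Q.NonNegative (c * ℕtoℚ n)
    cn≥0 = Q.nonNeg*nonNeg⇒nonNeg c (ℕtoℚ n) {{Q.nonNegative (ℕtoℚ-mono {0} {n} ℕ.z≤n)}}
    F≤30Lu : F Q.≤ 15 · (L · u + L · u)
    F≤30Lu = Q.≤-trans F≤ (·-monoʳ 15 (Q.≤-trans (·-monoˡ 0≤u (ℕ.+-monoˡ-≤ L 1≤L))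
      (Q.≤-reflexive (+-· L L u))))
    identity₁ : ∀ n L u → (ℤ.+ 1 Q./ 120) * n * (ℕtoℚ 15 * (L * u + L * u))
      ≡ L * ((ℤ.+ 1 Q./ 4) * (n * u))
    identity₁ = solve-∀ ringℚ
    identity₂ : ∀ L G → L * ((ℤ.+ 1 Q./ 4) * (ℕtoℚ 4 * G)) ≡ G * L
    identity₂ = solve-∀ ringℚ

⌈n/2⌉≤1+⌊n/2⌋ : ∀ n → ℕ.⌈ n /2⌉ ≤ suc ℕ.⌊ n /2⌋
⌈n/2⌉≤1+⌊n/2⌋ n = ℕ.⌊n/2⌋-mono (ℕ.n≤1+n (suc n))

2^≤⇒≤log₂ : ∀ {n} i → 2 ℕ.^ i ≤ n → i ≤ ⌊log₂ n ⌋
2^≤⇒≤log₂ {n} i 2^i≤n = subst (_≤ ⌊log₂ n ⌋) (⌊log₂[2^n]⌋≡n i) (⌊log₂⌋-mono-≤ 2^i≤n)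

mainTheorem8 : Σ ℚ (λ c → (0ℚ < c) × ((n : ℕ) → 2 ≤ n → (A : OnlineAlgorithm n) →
    Σ (Instance n) (λ J → Σ (ValidInstance J) (λ v → Σ (NPSchedule J) (λ σ →
    c * ℕtoℚ n * npFlow σ Q.≤ execFlow (execute A J v) * ℕtoℚ ⌊log₂ n ⌋)))))
mainTheorem8 = (ℤ.+ 1 Q./ 120) , Q.*<* (ℤ.+<+ (ℕ.s≤s ℕ.z≤n)) , theorem
  where
  theorem : (n : ℕ) → 2 ≤ n → (A : OnlineAlgorithm n) →
    Σ (Instance n) (λ J → Σ (ValidInstance J) (λ v → Σ (NPSchedule J) (λ σ →
    (ℤ.+ 1 Q./ 120) * ℕtoℚ n * npFlow σ Q.≤ execFlow (execute A J v) * ℕtoℚ ⌊log₂ n ⌋)))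
  theorem (suc zero) (ℕ.s≤s ())
  theorem (suc (suc m)) 2≤n A = conclude (Adversary.lower-bound m L ℕ.⌊ m /2⌋ ℕ.⌈ m /2⌉ A u
    (suc L · u) 0<u (ℕ.⌊n/2⌋+⌈n/2⌉≡n m) (ℕ.⌊n/2⌋≤⌈n/2⌉ m) (⌈n/2⌉≤1+⌊n/2⌋ m) Q.≤-refl
    2^≤⇒≤log₂ m²≤h)
    where
    n L : ℕ
    n = suc (suc m)
    L = ⌊log₂ n ⌋
    u : ℚ
    -- Large enough for `h` to cover the offline flow of the tiny jobs, at most `m * m`.
    u = ℕtoℚ (n ℕ.* n)
    0<u : 0ℚ < u
    0<u = Q.<-≤-trans (Q.*<* (ℤ.+<+ (ℕ.s≤s ℕ.z≤n))) (ℕtoℚ-mono {1} {n ℕ.* n} (ℕ.s≤s ℕ.z≤n))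
    m²≤h : ℕtoℚ (m ℕ.* m) Q.≤ suc L · u
    m²≤h = Q.≤-trans (ℕtoℚ-mono (ℕ.*-mono-≤ (ℕ.m≤n+m m 2) (ℕ.m≤n+m m 2)))
      (Q.≤-trans (Q.≤-reflexive (sym (1-· u))) (·-monoˡ (Q.<⇒≤ 0<u) (ℕ.s≤s (ℕ.z≤n {L}))))
    conclude : Adversary.Outcome m L ℕ.⌊ m /2⌋ ℕ.⌈ m /2⌉ A u (suc L · u) 0<u
      (ℕ.⌊n/2⌋+⌈n/2⌉≡n m) (ℕ.⌊n/2⌋≤⌈n/2⌉ m) (⌈n/2⌉≤1+⌊n/2⌋ m) Q.≤-refl 2^≤⇒≤log₂ m²≤h →
      Σ (Instance n) (λ J → Σ (ValidInstance J) (λ v → Σ (NPSchedule J) (λ σ →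
      (ℤ.+ 1 Q./ 120) * ℕtoℚ n * npFlow σ Q.≤ execFlow (execute A J v) * ℕtoℚ L)))
    conclude (J , v , σ , cheap , costly) =
      J , v , σ , ratio-bound {n} (2^≤⇒≤log₂ 1 2≤n) (Q.<⇒≤ 0<u) cheap costly
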